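{- Let $n>1$ and $e\ge n-1$ be integers and let $p$ be a prime. Let $$b(n,e) = \max_{0 \leq d \leq n-1} \left\lfloor\frac{e}{n-1+d}\right\rfloor \cdot d\,(n-1-d),$$ where the maximum is over all integers $d$ with $0\le d\le n-1$. Then $$f_n(p^e)\geq p^{b(n,e)}.$$
   Context: A subring of $\mathbb{Z}^n$ is a sublattice (additive subgroup) of $\mathbb{Z}^n$ that contains the multiplicative identity $(1,1,\ldots,1)$ and is closed under componentwise multiplication. For a positive integer $m$, $f_n(m)$ denotes the number of subrings of $\mathbb{Z}^n$ of finite index $m$. -}

module Defs where

open import Data.Fin.Base using (Fin; toℕ)
open import Data.Fin.Properties using (injective⇒≤; pigeonhole; toℕ<n) renaming (_≟_ to _≟ᶠ_)
open import Data.Integer.Base as ℤ using (ℤ; +_; 0ℤ; 1ℤ)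
import Data.Integer.Properties as ℤ
import Data.Integer.DivMod as ℤ
open import Data.Integer.Divisibility.Signed as ℤ∣ using (divides) renaming (_∣_ to _∣ℤ_; _∣?_ to _∣ℤ?_)
open import Data.Integer.Tactic.RingSolver using (solve-∀)
open import Data.List.Base as List using (List; []; _∷_; upTo)
open import Data.List.Extrema.Nat using (max)
open import Data.List.Membership.Propositional using (_∈_)
open import Data.List.Membership.Propositional.Properties
  using (∈-map⁺; ∈-++⁺ˡ; ∈-++⁺ʳ; ∈-cartesianProductWith⁺; ∈-upTo⁺; ∈-filter⁺; ∈-filter⁻)
import Data.List.Relation.Unary.All as All
open import Data.List.Relation.Unary.All using (All)
import Data.List.Relation.Unary.Any as Any
open import Data.List.Relation.Unary.Any using (Any; here; there)
import Data.List.Relation.Unary.Any.Properties as Any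
import Data.List.Membership.Setoid.Properties as SetoidMembership
open import Data.List.Relation.Unary.AllPairs using (AllPairs; _∷_)
open import Data.List.Relation.Unary.Enumerates.Setoid using (IsEnumeration)
open import Data.List.Relation.Unary.Enumerates.Setoid.Properties using (deduplicate⁺)
open import Data.List.Relation.Unary.Unique.DecSetoid.Properties using (deduplicate-!)
open import Data.Maybe.Base using (Maybe; just; nothing)
import Data.Maybe.Relation.Unary.Any as Maybe
open import Data.Nat.Base as ℕ using (ℕ; zero; suc; _∸_; _!; NonZero; NonTrivial)
import Data.Nat.Properties as ℕ
import Data.Nat.Divisibility as ℕ∣
open import Data.Nat.DivMod using (_/_)
open import Data.Product.Base using (Σ; ∃; _×_; _,_; proj₁; proj₂)
open import Data.Vec.Base as Vec using (Vec; []; _∷_)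
open import Data.Vec.Relation.Binary.Pointwise.Inductive as Pointwise using (Pointwise; []; _∷_)
open import Data.Empty using (⊥-elim)
open import Function.Bundles using (Bijection)
open import Level using (Level; 0ℓ; _⊔_) renaming (suc to lsuc)
open import Relation.Binary.Bundles using (Setoid; DecSetoid)
open import Relation.Binary.PropositionalEquality as ≡ using (_≡_; refl; sym; trans; cong; cong₂; subst)
open import Relation.Nullary using (Dec; yes; no)
open import Relation.Nullary.Decidable using (map′; _×-dec_; _→-dec_)
open import Relation.Unary using (Pred; _≐_; Decidable)
open import Relation.Unary.Properties using (≐-refl; ≐-sym; ≐-trans)

private
  variable
    a ℓ : Level
    n : ℕ

ℤ^_ : ℕ → Set
ℤ^ n = Vec ℤ n

infixl 6 _+ᵛ_ _-ᵛ_
infixl 7 _*ᵛ_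

_+ᵛ_ _*ᵛ_ _-ᵛ_ : ℤ^ n → ℤ^ n → ℤ^ n
_+ᵛ_ = Vec.zipWith ℤ._+_
_*ᵛ_ = Vec.zipWith ℤ._*_

negᵛ : ℤ^ n → ℤ^ n
negᵛ = Vec.map λ a → ℤ.- a

x -ᵛ y = x +ᵛ negᵛ y

0ᵛ 1ᵛ : ℤ^ n
0ᵛ = Vec.replicate _ 0ℤ
1ᵛ = Vec.replicate _ 1ℤ

record IsSubring {n} (S : Pred (ℤ^ n) 0ℓ) : Set where
  field
    0∈       : S 0ᵛ
    +-closed : ∀ {x y} → S x → S y → S (x +ᵛ y)
    -‿closed : ∀ {x} → S x → S (negᵛ x)
    1∈       : S 1ᵛ
    *-closed : ∀ {x y} → S x → S y → S (x *ᵛ y)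

record Subring (n : ℕ) : Set₁ where
  field
    Mem       : Pred (ℤ^ n) 0ℓ
    isSubring : IsSubring Mem
  open IsSubring isSubring public

HasSize : Setoid a ℓ → ℕ → Set (a ⊔ ℓ)
HasSize A k = Bijection A (≡.setoid (Fin k))

private
  x-x≡0 : (x : ℤ^ n) → x -ᵛ x ≡ 0ᵛ
  x-x≡0 []      = refl
  x-x≡0 (a ∷ x) = cong₂ _∷_ (ℤ.+-inverseʳ a) (x-x≡0 x)

  -[x-y]≡y-x : (x y : ℤ^ n) → negᵛ (x -ᵛ y) ≡ y -ᵛ x
  -[x-y]≡y-x []      []      = refl
  -[x-y]≡y-x (a ∷ x) (b ∷ y) = cong₂ _∷_ (lemma a b) (-[x-y]≡y-x x y)
    where
    lemma : ∀ a b → ℤ.- (a ℤ.+ ℤ.- b) ≡ b ℤ.+ ℤ.- a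
    lemma = solve-∀

  [x-y]+[y-z]≡x-z : (x y z : ℤ^ n) → (x -ᵛ y) +ᵛ (y -ᵛ z) ≡ x -ᵛ z
  [x-y]+[y-z]≡x-z []      []      []      = refl
  [x-y]+[y-z]≡x-z (a ∷ x) (b ∷ y) (c ∷ z) = cong₂ _∷_ (lemma a b c) ([x-y]+[y-z]≡x-z x y z)
    where
    lemma : ∀ a b c → (a ℤ.+ ℤ.- b) ℤ.+ (b ℤ.+ ℤ.- c) ≡ a ℤ.+ ℤ.- c
    lemma = solve-∀

cosets : Subring n → Setoid 0ℓ 0ℓ
cosets {n} S = record
  { Carrier       = ℤ^ n
  ; _≈_           = λ x y → Mem (x -ᵛ y)
  ; isEquivalence = record
    { refl  = λ {x} → subst Mem (sym (x-x≡0 x)) 0∈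
    ; sym   = λ {x} {y} p → subst Mem (-[x-y]≡y-x x y) (-‿closed p)
    ; trans = λ {x} {y} {z} p q → subst Mem ([x-y]+[y-z]≡x-z x y z) (+-closed p q)
    }
  }
  where open Subring S

HasIndex : Subring n → ℕ → Set
HasIndex S m = HasSize (cosets S) m

-- The equality compares underlying sets only: neither the closure proofs
-- nor the chosen labelling of the cosets by Fin m is counted.  A
-- predicate S with HasIndex S m is automatically decidable, so nothing
-- is lost constructively.
subringsOfIndex : (n m : ℕ) → Setoid (lsuc 0ℓ) 0ℓ
subringsOfIndex n m = record
  { Carrier       = Σ (Subring n) λ S → HasIndex S m
  ; _≈_           = λ (S , _) (T , _) → Subring.Mem S ≐ Subring.Mem T
  ; isEquivalence = record
    { refl  = ≐-refl
    ; sym   = ≐-sym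
    ; trans = ≐-trans
    }
  }

HasSize-unique : (A : Setoid a ℓ) → ∀ {j k} → HasSize A j → HasSize A k → j ≡ k
HasSize-unique A F G = ℕ.≤-antisym (le F G) (le G F)
  where
  open Setoid A using () renaming (refl to ≈-refl)
  le : ∀ {j k} → HasSize A j → HasSize A k → j ℕ.≤ k
  le F G = injective⇒≤ {f = λ i → G.to (proj₁ (F.surjective i))} λ {i} {i′} eq →
    trans (sym (proj₂ (F.surjective i) ≈-refl))
          (trans (F.cong (G.injective eq)) (proj₂ (F.surjective i′) ≈-refl))
    where
    module F = Bijection F
    module G = Bijection G

module _ (D : DecSetoid a ℓ) where
  open DecSetoid D using (Carrier; _≈_; _≉_; _≟_)
    renaming (setoid to A; sym to ≈-sym; trans to ≈-trans; refl to ≈-refl)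

  private
    lookup-inj : ∀ {xs} → AllPairs _≉_ xs → ∀ i j → List.lookup xs i ≈ List.lookup xs j → i ≡ j
    lookup-inj (_ ∷ _) Fin.zero Fin.zero _ = refl
    lookup-inj {x ∷ xs} (x∉ ∷ _) Fin.zero (Fin.suc j) eq =
      ⊥-elim (All.lookupₛ A (λ y≈z x≉y x≈z → x≉y (≈-trans x≈z (≈-sym y≈z))) x∉
               (SetoidMembership.∈-lookup A xs j) eq)
    lookup-inj {x ∷ xs} (x∉ ∷ _) (Fin.suc i) Fin.zero eq =
      ⊥-elim (All.lookupₛ A (λ y≈z x≉y x≈z → x≉y (≈-trans x≈z (≈-sym y≈z))) x∉
               (SetoidMembership.∈-lookup A xs i) (≈-sym eq))
    lookup-inj (_ ∷ u) (Fin.suc i) (Fin.suc j) eq = cong Fin.suc (lookup-inj u i j eq)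

  enumeration⇒HasSize : ∀ {xs} → IsEnumeration A xs → ∃ (HasSize A)
  enumeration⇒HasSize {xs} enum = List.length ys , record
    { to        = to
    ; cong      = λ {x} {y} x≈y → inj _ _ (≈-trans (≈-sym (look x)) (≈-trans x≈y (look y)))
    ; bijective = (λ {x} {y} eq → ≈-trans (look x)
                     (subst (λ i → List.lookup ys i ≈ y) (sym eq) (≈-sym (look y))))
                , (λ i → List.lookup ys i , λ {z} z≈ → inj _ _ (≈-trans (≈-sym (look z)) z≈))
    }
    where
    ys = List.deduplicate _≟_ xs
    enum′ : IsEnumeration A ys
    enum′ = deduplicate⁺ D enum
    to : Carrier → Fin (List.length ys)
    to x = Any.index (enum′ x)
    look : ∀ x → x ≈ List.lookup ys (to x)
    look x = Any.lookup-index (enum′ x)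
    inj = lookup-inj (deduplicate-! D xs)

  HasSize? : ∀ {xs} → IsEnumeration A xs → ∀ k → Dec (HasSize A k)
  HasSize? enum k with enumeration⇒HasSize enum
  ... | j , size = map′ (λ j≡k → subst (HasSize A) j≡k size) (HasSize-unique A size) (j ℕ.≟ k)

-- By pigeonhole on cosets, a subring of index m contains M·ℤⁿ for
-- M = m!, hence is determined by the residues mod M that it contains.

private
  sublists : ∀ {A : Set a} → List A → List (List A)
  sublists []       = [] ∷ []
  sublists (x ∷ xs) = List.map (x ∷_) (sublists xs) List.++ sublists xs

  filter∈sublists : ∀ {A : Set a} {P : Pred A ℓ} (P? : Decidable P) xs →
                    List.filter P? xs ∈ sublists xs
  filter∈sublists P? []       = here refl
  filter∈sublists P? (x ∷ xs) with P? x
  ... | yes _ = ∈-++⁺ˡ (∈-map⁺ (x ∷_) (filter∈sublists P? xs))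
  ... | no  _ = ∈-++⁺ʳ _ (filter∈sublists P? xs)

  _·_ : ℕ → ℤ^ n → ℤ^ n
  k · x = Vec.map (λ a → + k ℤ.* a) x

  0·x≡0 : (x : ℤ^ n) → 0 · x ≡ 0ᵛ
  0·x≡0 []      = refl
  0·x≡0 (a ∷ x) = cong₂ _∷_ (ℤ.*-zeroˡ a) (0·x≡0 x)

  [1+k]·x≡x+k·x : ∀ k (x : ℤ^ n) → suc k · x ≡ x +ᵛ k · x
  [1+k]·x≡x+k·x k []      = refl
  [1+k]·x≡x+k·x k (a ∷ x) = cong₂ _∷_ (ℤ.suc-* (+ k) a) ([1+k]·x≡x+k·x k x)

  [j*k]·x≡j·k·x : ∀ j k (x : ℤ^ n) → (j ℕ.* k) · x ≡ j · (k · x)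
  [j*k]·x≡j·k·x j k []      = refl
  [j*k]·x≡j·k·x j k (a ∷ x) = cong₂ _∷_
    (trans (cong (λ t → t ℤ.* a) (ℤ.pos-* j k)) (ℤ.*-assoc (+ j) (+ k) a)) ([j*k]·x≡j·k·x j k x)

  j·x-i·x : ∀ k i (x : ℤ^ n) → ((k ℕ.+ i) · x) -ᵛ (i · x) ≡ k · x
  j·x-i·x k i []      = refl
  j·x-i·x k i (a ∷ x) = cong₂ _∷_
    (trans (cong (λ t → t ℤ.* a ℤ.+ ℤ.- (+ i ℤ.* a)) (ℤ.pos-+ k i)) (lemma (+ k) (+ i) a))
    (j·x-i·x k i x)
    where
    lemma : ∀ k i a → (k ℤ.+ i) ℤ.* a ℤ.+ ℤ.- (i ℤ.* a) ≡ k ℤ.* a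
    lemma = solve-∀

  k∣m! : ∀ {k m} .{{_ : NonZero k}} → k ℕ.≤ m → k ℕ∣.∣ m !
  k∣m! {suc k} k≤m = ℕ∣.∣-trans (ℕ∣.m∣m*n (k !)) (ℕ∣.m≤n⇒m!∣n! k≤m)

  x-0≡x : (x : ℤ^ n) → x -ᵛ 0ᵛ ≡ x
  x-0≡x []      = refl
  x-0≡x (a ∷ x) = cong₂ _∷_ (ℤ.+-identityʳ a) (x-0≡x x)

  module _ {m} (S : Subring n) (I : HasIndex S m) where
    open Subring S
    open Bijection I using (to; injective) renaming (cong to to-cong)

    ·-closed : ∀ k {x} → Mem x → Mem (k · x)
    ·-closed zero    {x} x∈ = subst Mem (sym (0·x≡0 x)) 0∈
    ·-closed (suc k) {x} x∈ = subst Mem (sym ([1+k]·x≡x+k·x k x)) (+-closed x∈ (·-closed k x∈))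

    m!·x∈ : ∀ x → Mem ((m !) · x)
    m!·x∈ x with pigeonhole (ℕ.n<1+n m) (λ i → to (toℕ i · x))
    ... | i , j , i<j , eq = result (k∣m! {{ℕ.>-nonZero (ℕ.m<n⇒0<n∸m i<j)}} k≤m)
      where
      k = toℕ j ∸ toℕ i
      k≤m : k ℕ.≤ m
      k≤m = ℕ.≤-trans (ℕ.m∸n≤m (toℕ j) (toℕ i)) (ℕ.≤-pred (toℕ<n j))
      k·x∈ : Mem (k · x)
      k·x∈ = subst Mem (trans (cong (λ t → (t · x) -ᵛ (toℕ i · x)) (sym (ℕ.m∸n+n≡m (ℕ.<⇒≤ i<j))))
                              (j·x-i·x k (toℕ i) x))
                       (injective (sym eq))
      result : k ℕ∣.∣ m ! → Mem ((m !) · x)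
      result (ℕ∣.divides q m!≡q*k) =
        subst Mem (trans (sym ([j*k]·x≡j·k·x q k x)) (cong (_· x) (sym m!≡q*k))) (·-closed q k·x∈)

    index⇒Mem? : Decidable Mem
    index⇒Mem? x = map′ (λ eq → subst Mem (x-0≡x x) (injective eq))
                        (λ x∈ → to-cong (subst Mem (sym (x-0≡x x)) x∈))
                        (to x ≟ᶠ to 0ᵛ)

  module Modulus (M : ℕ) .{{_ : NonZero M}} where

    _≈_ : ℤ^ n → ℤ^ n → Set
    _≈_ = Pointwise (λ a b → + M ∣ℤ a ℤ.- b)

    _≈?_ : (x y : ℤ^ n) → Dec (x ≈ y)
    _≈?_ = Pointwise.decidable (λ a b → + M ∣ℤ? (a ℤ.- b))

    ≈-refl : {x : ℤ^ n} → x ≈ x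
    ≈-refl = Pointwise.refl λ {a} → subst (+ M ∣ℤ_) (sym (ℤ.+-inverseʳ a)) (divides 0ℤ refl)

    ≈-trans : {x y z : ℤ^ n} → x ≈ y → y ≈ z → x ≈ z
    ≈-trans = Pointwise.trans λ {a} {b} {c} p q →
      subst (+ M ∣ℤ_) (lemma a b c) (ℤ∣.∣m∣n⇒∣m+n p q)
      where
      lemma : ∀ a b c → (a ℤ.- b) ℤ.+ (b ℤ.- c) ≡ a ℤ.- c
      lemma = solve-∀

    ≈-sym : {x y : ℤ^ n} → x ≈ y → y ≈ x
    ≈-sym = Pointwise.sym λ {a} {b} p → subst (+ M ∣ℤ_) (lemma a b) (ℤ∣.∣m⇒∣-m p)
      where
      lemma : ∀ a b → ℤ.- (a ℤ.- b) ≡ b ℤ.- a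
      lemma = solve-∀

    +-cong : {x x′ y y′ : ℤ^ n} → x ≈ x′ → y ≈ y′ → (x +ᵛ y) ≈ (x′ +ᵛ y′)
    +-cong []       []       = []
    +-cong {x = a ∷ _} {a′ ∷ _} {b ∷ _} {b′ ∷ _} (p ∷ ps) (q ∷ qs) =
      subst (+ M ∣ℤ_) (lemma a a′ b b′) (ℤ∣.∣m∣n⇒∣m+n p q) ∷ +-cong ps qs
      where
      lemma : ∀ a a′ b b′ → (a ℤ.- a′) ℤ.+ (b ℤ.- b′) ≡ (a ℤ.+ b) ℤ.- (a′ ℤ.+ b′)
      lemma = solve-∀

    -‿cong : {x x′ : ℤ^ n} → x ≈ x′ → (negᵛ x) ≈ (negᵛ x′)
    -‿cong []       = []
    -‿cong {x = a ∷ _} {a′ ∷ _} (p ∷ ps) =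
      subst (+ M ∣ℤ_) (lemma a a′) (ℤ∣.∣m⇒∣-m p) ∷ -‿cong ps
      where
      lemma : ∀ a a′ → ℤ.- (a ℤ.- a′) ≡ ℤ.- a ℤ.- ℤ.- a′
      lemma = solve-∀

    *-cong : {x x′ y y′ : ℤ^ n} → x ≈ x′ → y ≈ y′ → (x *ᵛ y) ≈ (x′ *ᵛ y′)
    *-cong []       []       = []
    *-cong {x = a ∷ _} {a′ ∷ _} {b ∷ _} {b′ ∷ _} (p ∷ ps) (q ∷ qs) =
      subst (+ M ∣ℤ_) (lemma a a′ b b′) (ℤ∣.∣m∣n⇒∣m+n (ℤ∣.∣m⇒∣m*n b p) (ℤ∣.∣n⇒∣m*n a′ q)) ∷ *-cong ps qs
      where
      lemma : ∀ a a′ b b′ → (a ℤ.- a′) ℤ.* b ℤ.+ a′ ℤ.* (b ℤ.- b′) ≡ a ℤ.* b ℤ.- a′ ℤ.* b′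
      lemma = solve-∀

    ≈⇒≡ : {x y : ℤ^ n} → x ≈ y → ∃ λ z → x ≡ y +ᵛ M · z
    ≈⇒≡ []       = [] , refl
    ≈⇒≡ {x = a ∷ _} {b ∷ _} (divides q eq ∷ ps) with ≈⇒≡ ps
    ... | z , refl = q ∷ z , cong (_∷ _) (trans (lemma a b) (cong (λ t → b ℤ.+ t) (trans eq (ℤ.*-comm q (+ M)))))
      where
      lemma : ∀ a b → a ≡ b ℤ.+ (a ℤ.- b)
      lemma = solve-∀

    residues : ∀ n → List (ℤ^ n)
    residues zero    = [] ∷ []
    residues (suc n) = List.cartesianProductWith _∷_ (List.map (λ k → + k) (upTo M)) (residues n)

    residue : (x : ℤ^ n) → ∃ λ r → r ∈ residues n × x ≈ r
    residue []      = [] , here refl , []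
    residue (a ∷ x) with residue x
    ... | r , r∈ , x≈r = + (a ℤ.%ℕ M) ∷ r
        , ∈-cartesianProductWith⁺ _∷_ (∈-map⁺ (λ k → + k) (∈-upTo⁺ (ℤ.n%ℕd<d a M))) r∈
        , (divides (a ℤ./ℕ M) eq ∷ x≈r)
      where
      lemma : ∀ r t → (r ℤ.+ t) ℤ.- r ≡ t
      lemma = solve-∀
      eq : a ℤ.- + (a ℤ.%ℕ M) ≡ (a ℤ./ℕ M) ℤ.* + M
      eq = trans (cong (λ t → t ℤ.- + (a ℤ.%ℕ M)) (ℤ.a≡a%ℕn+[a/ℕn]*n a M)) (lemma (+ (a ℤ.%ℕ M)) _)

    Closure : List (ℤ^ n) → Pred (ℤ^ n) 0ℓ
    Closure ps x = Any (x ≈_) ps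

    Closure? : (ps : List (ℤ^ n)) → Decidable (Closure ps)
    Closure? ps x = Any.any? (x ≈?_) ps

    Closure-resp : ∀ {ps} {x y : ℤ^ n} → x ≈ y → Closure ps y → Closure ps x
    Closure-resp x≈y = Any.map (≈-trans x≈y)

    ∈⇒Closure : ∀ {ps} {x : ℤ^ n} → x ∈ ps → Closure ps x
    ∈⇒Closure = Any.map λ { refl → ≈-refl }

    find : ∀ {ps} {x : ℤ^ n} → Closure ps x → ∃ λ r → r ∈ ps × x ≈ r
    find (here p)  = _ , here refl , p
    find (there p) with find p
    ... | r , r∈ , q = r , there r∈ , q

    isSubring? : (ps : List (ℤ^ n)) → Dec (IsSubring (Closure ps))
    isSubring? ps = map′ to from
      (C? 0ᵛ ×-dec C? 1ᵛ ×-dec All.all? (λ x → C? (negᵛ x)) ps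
        ×-dec All.all? (λ x → All.all? (λ y → C? (x +ᵛ y)) ps) ps
        ×-dec All.all? (λ x → All.all? (λ y → C? (x *ᵛ y)) ps) ps)
      where
      C = Closure ps
      C? = Closure? ps
      Finitary = C 0ᵛ × C 1ᵛ × All (λ x → C (negᵛ x)) ps
        × All (λ x → All (λ y → C (x +ᵛ y)) ps) ps
        × All (λ x → All (λ y → C (x *ᵛ y)) ps) ps
      to : Finitary → IsSubring C
      to (z , o , neg , add , mul) = record
        { 0∈       = z
        ; 1∈       = o
        ; -‿closed = λ x∈ → let _ , r∈ , x≈ = find x∈ in
            Closure-resp (-‿cong x≈) (All.lookup neg r∈)
        ; +-closed = λ x∈ y∈ → let _ , r∈ , x≈ = find x∈; _ , s∈ , y≈ = find y∈ in
            Closure-resp (+-cong x≈ y≈) (All.lookup (All.lookup add r∈) s∈)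
        ; *-closed = λ x∈ y∈ → let _ , r∈ , x≈ = find x∈; _ , s∈ , y≈ = find y∈ in
            Closure-resp (*-cong x≈ y≈) (All.lookup (All.lookup mul r∈) s∈)
        }
      from : IsSubring C → Finitary
      from R = 0∈ , 1∈ , All.tabulate (λ r∈ → -‿closed (∈⇒Closure r∈))
        , All.tabulate (λ r∈ → All.tabulate λ s∈ → +-closed (∈⇒Closure r∈) (∈⇒Closure s∈))
        , All.tabulate (λ r∈ → All.tabulate λ s∈ → *-closed (∈⇒Closure r∈) (∈⇒Closure s∈))
        where open IsSubring R

    hasIndex? : ∀ ps (R : IsSubring {n} (Closure ps)) m →
                Dec (HasIndex (record { Mem = Closure ps ; isSubring = R }) m)
    hasIndex? {n} ps R m = HasSize? D {residues n} enum m
      where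
      D : DecSetoid 0ℓ 0ℓ
      D = record
        { isDecEquivalence = record
          { isEquivalence = Setoid.isEquivalence (cosets (record { Mem = Closure ps ; isSubring = R }))
          ; _≟_           = λ x y → Closure? ps (x -ᵛ y)
          }
        }
      enum : IsEnumeration (DecSetoid.setoid D) (residues n)
      enum x with residue x
      ... | r , r∈ , x≈r = Any.map
        (λ { refl → Closure-resp (subst ((x -ᵛ r) ≈_) (x-x≡0 r) (+-cong x≈r ≈-refl)) (IsSubring.0∈ R) }) r∈

  module Finite (n m : ℕ) where
    open Modulus (m !) {{m ℕ.!≢0}}
    open Setoid (subringsOfIndex n m) using () renaming (Carrier to A; _≈_ to _≈ᴬ_)

    mem : A → Pred (ℤ^ n) 0ℓ
    mem (S , _) = Subring.Mem S

    mem-resp : ∀ (S : A) {x y} → x ≈ y → mem S y → mem S x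
    mem-resp (S , I) x≈y y∈ with ≈⇒≡ x≈y
    ... | z , refl = Subring.+-closed S y∈ (m!·x∈ S I z)

    mem? : (S : A) → Decidable (mem S)
    mem? (S , I) = index⇒Mem? S I

    ⊆? : (S T : A) → Dec (∀ {x} → mem S x → mem T x)
    ⊆? S T = map′
      (λ h {x} x∈ → let r , r∈ , x≈r = residue x in
         mem-resp T x≈r (All.lookup h r∈ (mem-resp S (≈-sym x≈r) x∈)))
      (λ h → All.tabulate λ _ → h)
      (All.all? (λ r → mem? S r →-dec mem? T r) (residues n))

    decSetoid : DecSetoid (lsuc 0ℓ) 0ℓ
    decSetoid = record
      { isDecEquivalence = record
        { isEquivalence = Setoid.isEquivalence (subringsOfIndex n m)
        ; _≟_           = λ S T → ⊆? S T ×-dec ⊆? T S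
        }
      }

    candidate : List (ℤ^ n) → Maybe A
    candidate ps with isSubring? ps
    ... | no  _ = nothing
    ... | yes R with hasIndex? ps R m
    ...   | no  _ = nothing
    ...   | yes I = just (record { Mem = Closure ps ; isSubring = R } , I)

    candidate-complete : ∀ (S : A) ps → mem S ≐ Closure ps → Maybe.Any (S ≈ᴬ_) (candidate ps)
    candidate-complete (S , I) ps eq@(S⊆C , C⊆S) with isSubring? ps
    ... | no ¬R = ⊥-elim (¬R record
      { 0∈       = S⊆C 0∈
      ; 1∈       = S⊆C 1∈
      ; -‿closed = λ x∈ → S⊆C (-‿closed (C⊆S x∈))
      ; +-closed = λ x∈ y∈ → S⊆C (+-closed (C⊆S x∈) (C⊆S y∈))
      ; *-closed = λ x∈ y∈ → S⊆C (*-closed (C⊆S x∈) (C⊆S y∈))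
      })
      where open Subring S
    ... | yes R with hasIndex? ps R m
    ...   | yes I′ = Maybe.just eq
    ...   | no ¬I  = ⊥-elim (¬I record
      { to        = to
      ; cong      = λ p → to-cong (C⊆S p)
      ; bijective = (λ p → S⊆C (injective p))
                  , (λ i → let x , h = surjective i in x , λ p → h (C⊆S p))
      })
      where open Bijection I using (to; injective; surjective) renaming (cong to to-cong)

    enumeration : List A
    enumeration = List.mapMaybe candidate (sublists (residues n))

    isEnumeration : IsEnumeration (subringsOfIndex n m) enumeration
    isEnumeration S = Any.mapMaybe⁺ candidate _ (Any.map⁺
      (Any.map (λ { refl → candidate-complete S ps (S⊆C , C⊆S) }) (filter∈sublists (mem? S) (residues n))))
      where
      ps = List.filter (mem? S) (residues n)
      S⊆C : ∀ {x} → mem S x → Closure ps x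
      S⊆C {x} x∈ with residue x
      ... | r , r∈ , x≈r =
        Closure-resp x≈r (∈⇒Closure (∈-filter⁺ (mem? S) r∈ (mem-resp S (≈-sym x≈r) x∈)))
      C⊆S : ∀ {x} → Closure ps x → mem S x
      C⊆S {x} x∈ with find x∈
      ... | r , r∈ , x≈r = mem-resp S x≈r (proj₂ (∈-filter⁻ (mem? S) {xs = residues n} r∈))

abstract
  subringsOfIndex-finite : ∀ n m → ∃ (HasSize (subringsOfIndex n m))
  subringsOfIndex-finite n m = enumeration⇒HasSize (Finite.decSetoid n m) (Finite.isEnumeration n m)

-- The number of subrings of index m; it is 0 for m = 0, as ℤⁿ / S is
-- never empty.
f : ℕ → ℕ → ℕ
f n m = proj₁ (subringsOfIndex-finite n m)

f-counts : ∀ n m → HasSize (subringsOfIndex n m) (f n m)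
f-counts n m = proj₂ (subringsOfIndex-finite n m)

n-1+d≢0 : ∀ n d .{{_ : NonTrivial n}} → NonZero (n ∸ 1 ℕ.+ d)
n-1+d≢0 (suc (suc n)) d = _

b-term : ∀ n .{{_ : NonTrivial n}} (e d : ℕ) → ℕ
b-term n e d = (e / (n ∸ 1 ℕ.+ d)) {{n-1+d≢0 n d}} ℕ.* d ℕ.* (n ∸ 1 ∸ d)

-- The range upTo n is d = 0, …, n - 1.  The default value 0 of max is
-- also the term at d = 0, and every truncated subtraction is exact.
b : ∀ n .{{_ : NonTrivial n}} (e : ℕ) → ℕ
b n e = max 0 (List.map (b-term n e) (upTo n))

-- Subrings of ℤⁿ correspond to multiplicatively closed sublattices L of
-- ℤⁿ⁻¹ of the same index.  Put P = pᵏ with k = ⌊e / (n-1+d)⌋: every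
-- sublattice between P²ℤⁿ⁻¹ and Pℤⁿ⁻¹ is multiplicatively closed, and each
-- matrix A over ℤ/P with n-1-d rows and d columns gives one of index
-- P^(n-1+d), spanned by P²ℤᵈ and the rows P(e_h - A_h).  To reach the index
-- pᵉ exactly, the first of these rows becomes p^r·P e₁ - P A₁, where r is
-- e mod n-1+d; this keeps the lattice closed and A can still be read off.

module Submission where

open import Defs using (f; b)
open import Data.Nat.Base using (ℕ; NonTrivial; _∸_; _^_; _≤_)
open import Data.Nat.Primality using (Prime)

open import Defs using
  ( ℤ^_; _+ᵛ_; _*ᵛ_; _-ᵛ_; negᵛ; 0ᵛ; 1ᵛ; Subring; HasIndex
  ; subringsOfIndex; f-counts; b-term)
open import Data.Fin.Base as Fin using (Fin; toℕ; fromℕ<; combine; remQuot; finToFun; funToFin)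
import Data.Fin.Properties as Fin
open import Data.Integer.Base as ℤ using (ℤ; +_; 0ℤ; 1ℤ; -1ℤ)
import Data.Integer.DivMod as ℤ
import Data.Integer.Properties as ℤ
open import Algebra.Properties.AbelianGroup ℤ.+-0-abelianGroup
  using () renaming (∙-cancelˡ to +ℤ-cancelˡ)
open import Data.Integer.Divisibility.Signed as ℤ∣ using (divides) renaming (_∣_ to _∣ℤ_)
open import Data.Integer.Tactic.RingSolver using (solve-∀)
open import Data.List.Extrema.Nat using (argmax-all)
import Data.List.Relation.Unary.All.Properties as List
open import Data.Nat.Base as ℕ using (zero; suc; _<_; NonZero; _+_; _*_; s≤s)
open import Data.Nat.Divisibility using (_∣_; >⇒∤)
open import Data.Nat.DivMod using (_/_; _%_; m≡m%n+[m/n]*n)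
open import Data.Nat.Primality using (prime⇒nonZero)
import Data.Nat.Properties as ℕ
import Data.Nat.Tactic.RingSolver as ℕ-Solver
open import Data.Product.Base using (∃; _×_; _,_; proj₁; proj₂)
open import Data.Sum.Base using (inj₁; inj₂)
open import Data.Unit.Base using (tt)
open import Data.Vec.Base as Vec using ([]; _∷_; _++_; tabulate)
open import Data.Vec.Properties using (zipWith-comm; zipWith-inverseˡ)
open import Data.Vec.Relation.Unary.All using (All; []; _∷_)
open import Function.Base using (_∘_; id)
open import Function.Bundles using (Bijection)
open import Level using (0ℓ)
open import Relation.Binary.Bundles using (Setoid)
open import Relation.Binary.PropositionalEquality
  using (_≡_; refl; sym; trans; cong; cong₂; subst; subst₂; module ≡-Reasoning)
open import Relation.Nullary using (¬_; contradiction; yes; no)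
open import Relation.Unary using (Pred; _⊆_; U)

private
  variable
    d j m n s P Q : ℕ

-- Vector identities over the integers.

infixr 7 _•_

_•_ : ℤ → ℤ^ n → ℤ^ n
t • x = Vec.map (t ℤ.*_) x

x+0•a≡x : (x a : ℤ^ n) → x +ᵛ 0ℤ • a ≡ x
x+0•a≡x []       []       = refl
x+0•a≡x (x ∷ xs) (a ∷ as) = cong₂ _∷_ (lemma x a) (x+0•a≡x xs as)
  where
  lemma : ∀ x a → x ℤ.+ 0ℤ ℤ.* a ≡ x
  lemma = solve-∀

x+t•0≡x : ∀ t (x : ℤ^ n) → x +ᵛ t • 0ᵛ ≡ x
x+t•0≡x t []       = refl
x+t•0≡x t (x ∷ xs) = cong₂ _∷_ (lemma t x) (x+t•0≡x t xs)
  where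
  lemma : ∀ t x → x ℤ.+ t ℤ.* 0ℤ ≡ x
  lemma = solve-∀

0-1•x≡-x : (x : ℤ^ n) → 0ᵛ +ᵛ -1ℤ • x ≡ negᵛ x
0-1•x≡-x []       = refl
0-1•x≡-x (x ∷ xs) = cong₂ _∷_ (lemma x) (0-1•x≡-x xs)
  where
  lemma : ∀ x → 0ℤ ℤ.+ -1ℤ ℤ.* x ≡ ℤ.- x
  lemma = solve-∀

x+1•y≡x+y : (x y : ℤ^ n) → x +ᵛ 1ℤ • y ≡ x +ᵛ y
x+1•y≡x+y []       []       = refl
x+1•y≡x+y (x ∷ xs) (y ∷ ys) = cong₂ _∷_ (cong (λ z → x ℤ.+ z) (ℤ.*-identityˡ y)) (x+1•y≡x+y xs ys)

[x+s•a]+t•[y+r•a] : ∀ s t r (x y a : ℤ^ n) →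
  (x +ᵛ s • a) +ᵛ t • (y +ᵛ r • a) ≡ (x +ᵛ t • y) +ᵛ (s ℤ.+ t ℤ.* r) • a
[x+s•a]+t•[y+r•a] s t r []       []       []       = refl
[x+s•a]+t•[y+r•a] s t r (x ∷ xs) (y ∷ ys) (a ∷ as) =
  cong₂ _∷_ (lemma s t r x y a) ([x+s•a]+t•[y+r•a] s t r xs ys as)
  where
  lemma : ∀ s t r x y a → (x ℤ.+ s ℤ.* a) ℤ.+ t ℤ.* (y ℤ.+ r ℤ.* a)
                        ≡ (x ℤ.+ t ℤ.* y) ℤ.+ (s ℤ.+ t ℤ.* r) ℤ.* a
  lemma = solve-∀

[x+s•a]-[y+t•a] : ∀ s t (x y a : ℤ^ n) →
  (x +ᵛ s • a) -ᵛ (y +ᵛ t • a) ≡ (x -ᵛ y) +ᵛ (s ℤ.- t) • a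
[x+s•a]-[y+t•a] s t []       []       []       = refl
[x+s•a]-[y+t•a] s t (x ∷ xs) (y ∷ ys) (a ∷ as) =
  cong₂ _∷_ (lemma s t x y a) ([x+s•a]-[y+t•a] s t xs ys as)
  where
  lemma : ∀ s t x y a → (x ℤ.+ s ℤ.* a) ℤ.- (y ℤ.+ t ℤ.* a) ≡ (x ℤ.- y) ℤ.+ (s ℤ.- t) ℤ.* a
  lemma = solve-∀

1-1≡0 : ∀ n → 1ᵛ {n} +ᵛ 1ℤ • negᵛ 1ᵛ ≡ 0ᵛ
1-1≡0 zero    = refl
1-1≡0 (suc n) = cong (0ℤ ∷_) (1-1≡0 n)

-- `X` and `Y` are the tails left after subtracting `s` and `t` times the all-ones vector. When both
-- lie in a closed lattice, so does the left side; this makes `unitalization` closed under products.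
x*y-st : ∀ s t (x y : ℤ^ n) → let X = x +ᵛ s • negᵛ 1ᵛ; Y = y +ᵛ t • negᵛ 1ᵛ in
  (X *ᵛ Y +ᵛ t • X) +ᵛ s • Y ≡ x *ᵛ y +ᵛ (s ℤ.* t) • negᵛ 1ᵛ
x*y-st s t []       []       = refl
x*y-st s t (x ∷ xs) (y ∷ ys) = cong₂ _∷_ (lemma s t x y) (x*y-st s t xs ys)
  where
  lemma : ∀ s t x y → let X = x ℤ.+ s ℤ.* -1ℤ; Y = y ℤ.+ t ℤ.* -1ℤ in
    (X ℤ.* Y ℤ.+ t ℤ.* X) ℤ.+ s ℤ.* Y ≡ x ℤ.* y ℤ.+ (s ℤ.* t) ℤ.* -1ℤ
  lemma = solve-∀

-- Sublattices and their index.

record IsSublattice (L : Pred (ℤ^ n) 0ℓ) : Set where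
  field
    0∈     : L 0ᵛ
    linear : ∀ {x y} t → L x → L y → L (x +ᵛ t • y)

  +-closed : ∀ {x y} → L x → L y → L (x +ᵛ y)
  +-closed {x} {y} x∈ y∈ = subst L (x+1•y≡x+y x y) (linear 1ℤ x∈ y∈)

  -‿closed : ∀ {x} → L x → L (negᵛ x)
  -‿closed {x} x∈ = subst L (0-1•x≡-x x) (linear -1ℤ 0∈ x∈)

*-Closed : Pred (ℤ^ n) 0ℓ → Set
*-Closed L = ∀ {x y} → L x → L y → L (x *ᵛ y)

-- Labels and representatives are plain functions, for any predicate and not only for a subring, so
-- that `Ext-index` can assemble them one row at a time.
record Index (L : Pred (ℤ^ n) 0ℓ) (j : ℕ) : Set where
  field
    label     : ℤ^ n → Fin j
    rep       : Fin j → ℤ^ n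
    label-rep : ∀ i → label (rep i) ≡ i
    sound     : ∀ {x y} → label x ≡ label y → L (x -ᵛ y)
    complete  : ∀ {x y} → L (x -ᵛ y) → label x ≡ label y

Index⇒HasIndex : ∀ {j} (S : Subring n) → Index (Subring.Mem S) j → HasIndex S j
Index⇒HasIndex S I = record
  { to        = label
  ; cong      = complete
  ; bijective = sound , λ i → rep i , λ z≈ → trans (complete z≈) (label-rep i)
  }
  where open Index I

-- Uniqueness of division with remainder.

∣m⊖n∣≡∣m-n∣ : ∀ m n → ℤ.∣ m ℤ.⊖ n ∣ ≡ ℕ.∣ m - n ∣
∣m⊖n∣≡∣m-n∣ zero    zero    = refl
∣m⊖n∣≡∣m-n∣ zero    (suc n) = refl
∣m⊖n∣≡∣m-n∣ (suc m) zero    = refl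
∣m⊖n∣≡∣m-n∣ (suc m) (suc n) = trans (cong ℤ.∣_∣ (ℤ.[1+m]⊖[1+n]≡m⊖n m n)) (∣m⊖n∣≡∣m-n∣ m n)

-- The distance of `a` and `b` is below `m`, and a nonzero number below `m` is no multiple of `m`.
∣-bounded⇒≡ : ∀ {m a b} → a < m → b < m → + m ∣ℤ + a ℤ.- + b → a ≡ b
∣-bounded⇒≡ {m} {a} {b} a<m b<m m∣ with a ℕ.≟ b
... | yes a≡b = a≡b
... | no  a≢b = contradiction (ℤ∣.∣⇒∣ᵤ m∣)
  (subst (λ k → ¬ (m ∣ k)) (sym (trans (cong ℤ.∣_∣ (ℤ.m-n≡m⊖n a b)) (∣m⊖n∣≡∣m-n∣ a b)))
    (>⇒∤ {{ℕ.≢-nonZero (a≢b ∘ ℕ.∣m-n∣≡0⇒m≡n)}} lt))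
  where
  lt : ℕ.∣ a - b ∣ < m
  lt = ℕ.≤-<-trans (ℕ.∣m-n∣≤m⊔n a b) (ℕ.⊔-pres-<m a<m b<m)

division-unique : ∀ .{{_ : NonZero m}} (r r′ : Fin m) {q q′} →
  + toℕ r ℤ.+ q ℤ.* + m ≡ + toℕ r′ ℤ.+ q′ ℤ.* + m → r ≡ r′ × q ≡ q′
division-unique {m} r r′ {q} {q′} eq
  with Fin.toℕ-injective {i = r} {j = r′}
         (∣-bounded⇒≡ (Fin.toℕ<n r) (Fin.toℕ<n r′) (divides (q′ ℤ.- q) r-r′≡))
  where
  open ≡-Reasoning
  l1 : ∀ r r′ q m → r ℤ.- r′ ≡ (r ℤ.+ q ℤ.* m) ℤ.- (r′ ℤ.+ q ℤ.* m)
  l1 = solve-∀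
  l2 : ∀ r′ q q′ m → (r′ ℤ.+ q′ ℤ.* m) ℤ.- (r′ ℤ.+ q ℤ.* m) ≡ (q′ ℤ.- q) ℤ.* m
  l2 = solve-∀
  r-r′≡ : + toℕ r ℤ.- + toℕ r′ ≡ (q′ ℤ.- q) ℤ.* + m
  r-r′≡ = begin
    + toℕ r ℤ.- + toℕ r′
      ≡⟨ l1 (+ toℕ r) (+ toℕ r′) q (+ m) ⟩
    (+ toℕ r ℤ.+ q ℤ.* + m) ℤ.- (+ toℕ r′ ℤ.+ q ℤ.* + m)
      ≡⟨ cong (λ z → z ℤ.- (+ toℕ r′ ℤ.+ q ℤ.* + m)) eq ⟩
    (+ toℕ r′ ℤ.+ q′ ℤ.* + m) ℤ.- (+ toℕ r′ ℤ.+ q ℤ.* + m)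
      ≡⟨ l2 (+ toℕ r′) q q′ (+ m) ⟩
    (q′ ℤ.- q) ℤ.* + m ∎
... | refl = refl , ℤ.*-cancelʳ-≡ q q′ (+ m) (+ℤ-cancelˡ (+ toℕ r) _ _ eq)

-- Adjoining a pivot row to a lattice.

-- The sublattice spanned by the row (m , -a) and by 0 × L, so that iterating
-- Ext builds a lattice from its Hermite normal form.
Ext : ℕ → ℤ^ n → Pred (ℤ^ n) 0ℓ → Pred (ℤ^ (suc n)) 0ℓ
Ext m a L (u ∷ x) = ∃ λ t → u ≡ t ℤ.* + m × L (x +ᵛ t • a)

module _ {m : ℕ} {a : ℤ^ n} {L : Pred (ℤ^ n) 0ℓ} where

  Ext-isSublattice : IsSublattice L → IsSublattice (Ext m a L)
  Ext-isSublattice isL = record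
    { 0∈     = 0ℤ , refl , subst L (sym (x+0•a≡x 0ᵛ a)) 0∈
    ; linear = lin
    }
    where
    open IsSublattice isL
    lemma : ∀ s t r m → s ℤ.* m ℤ.+ t ℤ.* (r ℤ.* m) ≡ (s ℤ.+ t ℤ.* r) ℤ.* m
    lemma = solve-∀
    lin : ∀ {x y} t → Ext m a L x → Ext m a L y → Ext m a L (x +ᵛ t • y)
    lin {_ ∷ x} {_ ∷ y} t (s , refl , x∈) (r , refl , y∈) =
      s ℤ.+ t ℤ.* r , lemma s t r (+ m) , subst L ([x+s•a]+t•[y+r•a] s t r x y a) (linear t x∈ y∈)

  0∷⁺ : ∀ {x} → L x → Ext m a L (0ℤ ∷ x)
  0∷⁺ {x} x∈ = 0ℤ , refl , subst L (sym (x+0•a≡x x a)) x∈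

  pivot∈ : IsSublattice L → Ext m a L (+ m ∷ negᵛ a)
  pivot∈ isL = 1ℤ , sym (ℤ.*-identityˡ (+ m)) ,
    subst L (sym (trans (x+1•y≡x+y (negᵛ a) a) (zipWith-inverseˡ ℤ.+-inverseˡ a))) (IsSublattice.0∈ isL)

  module _ .{{_ : NonZero m}} where

    -- Since `m` is nonzero, the first coordinate determines the multiple `t` of the pivot row: 0
    -- here, and 1 in `m∷⁻`.
    0∷⁻ : ∀ {u x} → u ≡ 0ℤ → Ext m a L (u ∷ x) → L x
    0∷⁻ {x = x} refl (t , 0≡tm , x∈) with ℤ.*-cancelʳ-≡ 0ℤ t (+ m) 0≡tm
    ... | refl = subst L (x+0•a≡x x a) x∈

    m∷⁻ : ∀ {x} → Ext m a L (+ m ∷ x) → L (x +ᵛ a)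
    m∷⁻ {x} (t , m≡tm , x∈)
      with ℤ.*-cancelʳ-≡ 1ℤ t (+ m) (trans (ℤ.*-identityˡ (+ m)) m≡tm)
    ... | refl = subst L (x+1•y≡x+y x a) x∈

  -- Subtracting `quo u` times the row `(m , -a)` from `u ∷ x` leaves `rem u` in front and
  -- `x +ᵛ quo u • a` behind. A coset is thus named by a remainder mod `m` and a coset of `L`.
  Ext-index : .{{_ : NonZero m}} → Index L j → Index (Ext m a L) (m * j)
  Ext-index {j = j} I = record
    { label     = lab
    ; rep       = rp
    ; label-rep = lr
    ; sound     = λ {x} {y} → snd x y
    ; complete  = λ {x} {y} → cpl x y
    }
    where
    open Index I
    rem : ℤ → Fin m
    rem u = fromℕ< (ℤ.n%ℕd<d u m)
    quo : ℤ → ℤ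
    quo u = u ℤ./ℕ m
    rem-quo : ∀ u → u ≡ + toℕ (rem u) ℤ.+ quo u ℤ.* + m
    rem-quo u = trans (ℤ.a≡a%ℕn+[a/ℕn]*n u m)
      (cong (λ r → + r ℤ.+ quo u ℤ.* + m) (sym (Fin.toℕ-fromℕ< (ℤ.n%ℕd<d u m))))
    rem-quo-unique : ∀ {u} r q → u ≡ + toℕ r ℤ.+ q ℤ.* + m → rem u ≡ r × quo u ≡ q
    rem-quo-unique {u} r q eq = division-unique (rem u) r (trans (sym (rem-quo u)) eq)
    lab : ℤ^ (suc n) → Fin (m * j)
    lab (u ∷ x) = combine (rem u) (label (x +ᵛ quo u • a))
    rp : Fin (m * j) → ℤ^ (suc n)
    rp i = let r , c = remQuot {m} j i in + toℕ r ∷ rep c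
    lr : ∀ i → lab (rp i) ≡ i
    lr i = trans (cong₂ combine (proj₁ rq) (begin
        label (rep c +ᵛ quo (+ toℕ r) • a) ≡⟨ cong (λ q → label (rep c +ᵛ q • a)) (proj₂ rq) ⟩
        label (rep c +ᵛ 0ℤ • a)            ≡⟨ cong label (x+0•a≡x (rep c) a) ⟩
        label (rep c)                      ≡⟨ label-rep c ⟩
        c                                  ∎))
      (Fin.combine-remQuot {m} j i)
      where
      open ≡-Reasoning
      r = proj₁ (remQuot {m} j i)
      c = proj₂ (remQuot {m} j i)
      lemma : ∀ r m → r ≡ r ℤ.+ 0ℤ ℤ.* m
      lemma = solve-∀
      -- `+ toℕ r` is already reduced, so its quotient is 0.
      rq = rem-quo-unique r 0ℤ (lemma (+ toℕ r) (+ m))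
    snd : ∀ x y → lab x ≡ lab y → Ext m a L (x -ᵛ y)
    snd (u ∷ x) (w ∷ y) eq =
      let r≡ , c≡ = Fin.combine-injective (rem u) _ (rem w) _ eq in
      quo u ℤ.- quo w , u-w≡ r≡ , subst L ([x+s•a]-[y+t•a] (quo u) (quo w) x y a) (sound c≡)
      where
      lemma : ∀ r q q′ m → (r ℤ.+ q ℤ.* m) ℤ.- (r ℤ.+ q′ ℤ.* m) ≡ (q ℤ.- q′) ℤ.* m
      lemma = solve-∀
      u-w≡ : rem u ≡ rem w → u ℤ.- w ≡ (quo u ℤ.- quo w) ℤ.* + m
      u-w≡ r≡ = begin
        u ℤ.- w
          ≡⟨ cong₂ ℤ._-_ (rem-quo u) (rem-quo w) ⟩
        (+ toℕ (rem u) ℤ.+ quo u ℤ.* + m) ℤ.- (+ toℕ (rem w) ℤ.+ quo w ℤ.* + m)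
          ≡⟨ cong (λ r → (+ toℕ r ℤ.+ quo u ℤ.* + m) ℤ.- (+ toℕ (rem w) ℤ.+ quo w ℤ.* + m)) r≡ ⟩
        (+ toℕ (rem w) ℤ.+ quo u ℤ.* + m) ℤ.- (+ toℕ (rem w) ℤ.+ quo w ℤ.* + m)
          ≡⟨ lemma (+ toℕ (rem w)) (quo u) (quo w) (+ m) ⟩
        (quo u ℤ.- quo w) ℤ.* + m ∎
        where open ≡-Reasoning
    cpl : ∀ x y → Ext m a L (x -ᵛ y) → lab x ≡ lab y
    cpl (u ∷ x) (w ∷ y) (t , u-w≡tm , x-y∈) = cong₂ combine (proj₁ rq) (complete (subst L x-y≡ x-y∈))
      where
      open ≡-Reasoning
      l1 : ∀ u w → u ≡ w ℤ.+ (u ℤ.- w)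
      l1 = solve-∀
      l2 : ∀ r q m t → (r ℤ.+ q ℤ.* m) ℤ.+ t ℤ.* m ≡ r ℤ.+ (q ℤ.+ t) ℤ.* m
      l2 = solve-∀
      l3 : ∀ q t → t ≡ (q ℤ.+ t) ℤ.- q
      l3 = solve-∀
      -- As `u` exceeds `w` by `t` times `m`, the remainder is the same and the quotient grows by
      -- `t`.
      rq : rem u ≡ rem w × quo u ≡ quo w ℤ.+ t
      rq = rem-quo-unique (rem w) (quo w ℤ.+ t) (begin
        u                                              ≡⟨ l1 u w ⟩
        w ℤ.+ (u ℤ.- w)                                ≡⟨ cong₂ ℤ._+_ (rem-quo w) u-w≡tm ⟩
        + toℕ (rem w) ℤ.+ quo w ℤ.* + m ℤ.+ t ℤ.* + m  ≡⟨ l2 (+ toℕ (rem w)) (quo w) (+ m) t ⟩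
        + toℕ (rem w) ℤ.+ (quo w ℤ.+ t) ℤ.* + m        ∎)
      x-y≡ : (x -ᵛ y) +ᵛ t • a ≡ (x +ᵛ quo u • a) -ᵛ (y +ᵛ quo w • a)
      x-y≡ = begin
        (x -ᵛ y) +ᵛ t • a
          ≡⟨ cong (λ t → (x -ᵛ y) +ᵛ t • a) (l3 (quo w) t) ⟩
        (x -ᵛ y) +ᵛ (quo w ℤ.+ t ℤ.- quo w) • a
          ≡⟨ cong (λ q → (x -ᵛ y) +ᵛ (q ℤ.- quo w) • a) (proj₂ rq) ⟨
        (x -ᵛ y) +ᵛ (quo u ℤ.- quo w) • a
          ≡⟨ [x+s•a]-[y+t•a] (quo u) (quo w) x y a ⟨
        (x +ᵛ quo u • a) -ᵛ (y +ᵛ quo w • a) ∎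

-- The vectors with first coordinate 0 recover `L` from `Ext m a L`.
Ext-⊆⇒⊆ : ∀ .{{_ : NonZero m}} {a a′ : ℤ^ n} {L L′ : Pred (ℤ^ n) 0ℓ} →
          Ext m a L ⊆ Ext m a′ L′ → L ⊆ L′
Ext-⊆⇒⊆ {a = a} {a′} {L} {L′} E⊆E′ x∈ = 0∷⁻ {a = a′} {L′} refl (E⊆E′ (0∷⁺ {a = a} {L} x∈))

-- The pivot row `(m , -a)` lies in the second lattice; taking off that lattice's own pivot row
-- `(m , -a′)` leaves `a′ -ᵛ a`.
Ext-⊆⇒rows : ∀ .{{_ : NonZero m}} {a a′ : ℤ^ n} {L L′ : Pred (ℤ^ n) 0ℓ} →
             IsSublattice L → Ext m a L ⊆ Ext m a′ L′ → L′ (a′ -ᵛ a)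
Ext-⊆⇒rows {a = a} {a′} {L} {L′} isL E⊆E′ =
  subst L′ (zipWith-comm ℤ.+-comm (negᵛ a) a′) (m∷⁻ {a = a′} {L′} (E⊆E′ (pivot∈ {a = a} {L} isL)))

-- Subrings from multiplicatively closed sublattices.

module _ {L : Pred (ℤ^ n) 0ℓ} (isL : IsSublattice L) (*-closed : *-Closed L) where

  private
    -- `Ext` negates its row, so `negᵛ 1ᵛ` makes the pivot row the all-ones vector.
    E = Ext 1 (negᵛ 1ᵛ) L

    *-closed′ : *-Closed E
    *-closed′ {_ ∷ x} {_ ∷ y} (s , refl , x∈) (t , refl , y∈) = s ℤ.* t , lemma s t ,
      subst L (x*y-st s t x y) (linear s (linear t (*-closed x∈ y∈) x∈) y∈)
      where
      open IsSublattice isL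
      lemma : ∀ s t → (s ℤ.* 1ℤ) ℤ.* (t ℤ.* 1ℤ) ≡ (s ℤ.* t) ℤ.* 1ℤ
      lemma = solve-∀

  -- The subring ℤ·1 + (0 × L).
  unitalization : Subring (suc n)
  unitalization = record
    { Mem       = E
    ; isSubring = record
      { 0∈       = 0∈
      ; +-closed = +-closed
      ; -‿closed = -‿closed
      ; 1∈       = 1ℤ , refl , subst L (sym (1-1≡0 n)) (IsSublattice.0∈ isL)
      ; *-closed = *-closed′
      }
    }
    where open IsSublattice (Ext-isSublattice {m = 1} {negᵛ 1ᵛ} isL)

-- Divisibility of vectors and multiplicative closure.

Multiple : ℕ → Pred (ℤ^ n) 0ℓ
Multiple P = All (+ P ∣ℤ_)

Multiple-+ : {x y : ℤ^ n} → Multiple P x → Multiple P y → Multiple P (x +ᵛ y)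
Multiple-+ {x = []}    {[]}    []       []       = []
Multiple-+ {x = _ ∷ _} {_ ∷ _} (p ∷ ps) (q ∷ qs) = ℤ∣.∣m∣n⇒∣m+n p q ∷ Multiple-+ ps qs

Multiple-+•⁻ : ∀ t {x y : ℤ^ n} → Multiple P (x +ᵛ t • y) → Multiple P y → Multiple P x
Multiple-+•⁻ t {[]}    {[]}    []       []       = []
Multiple-+•⁻ t {_ ∷ _} {_ ∷ _} (p ∷ ps) (q ∷ qs) =
  ℤ∣.∣m+n∣n⇒∣m p (ℤ∣.∣n⇒∣m*n t q) ∷ Multiple-+•⁻ t ps qs

Multiple-• : ∀ P (x : ℤ^ n) → Multiple P (+ P • x)
Multiple-• P []       = []
Multiple-• P (x ∷ xs) = divides x (ℤ.*-comm (+ P) x) ∷ Multiple-• P xs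

∣-* : ∀ {a b} → + P ∣ℤ a → + Q ∣ℤ b → + (P * Q) ∣ℤ a ℤ.* b
∣-* {P} {Q} (divides s refl) (divides t refl) = divides (s ℤ.* t)
  (trans (lemma s t (+ P) (+ Q)) (cong (s ℤ.* t ℤ.*_) (sym (ℤ.pos-* P Q))))
  where
  lemma : ∀ s t P Q → (s ℤ.* P) ℤ.* (t ℤ.* Q) ≡ (s ℤ.* t) ℤ.* (P ℤ.* Q)
  lemma = solve-∀

Multiple-* : {x y : ℤ^ n} → Multiple P x → Multiple Q y → Multiple (P * Q) (x *ᵛ y)
Multiple-* {x = []}    {[]}    []       []       = []
Multiple-* {x = _ ∷ _} {_ ∷ _} (p ∷ ps) (q ∷ qs) = ∣-* p q ∷ Multiple-* ps qs

Multiple-t•P• : ∀ {t} (x : ℤ^ n) → + P ∣ℤ t → Multiple (P * P) (t • + P • x)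
Multiple-t•P• []       p = []
Multiple-t•P• {P = P} (x ∷ xs) p = ∣-* p (divides x (ℤ.*-comm (+ P) x)) ∷ Multiple-t•P• xs p

-- The pivot P * s need not divide P * P: a product of two multiples of it is
-- again a multiple of it, with a cofactor divisible by P.
Ext-*-closed : ∀ (a : ℤ^ n) {L} → Multiple (P * P) ⊆ L → L ⊆ Multiple P →
               *-Closed (Ext (P * s) (+ P • a) L)
Ext-*-closed {P = P} {s} a {L} P²⊆L L⊆P {_ ∷ x} {_ ∷ y} (t , refl , x∈) (r , refl , y∈) =
  t ℤ.* r ℤ.* + (P * s) , lemma t r (+ (P * s)) ,
  -- Both summands of the tail are divisible by `P * P`: each of `x` and `y` is a multiple of `P`,
  -- and the cofactor brings one `P` to the other in `+ P • a`.
  P²⊆L (Multiple-+ (Multiple-* (tail∈P t x∈) (tail∈P r y∈)) (Multiple-t•P• a (ℤ∣.∣n⇒∣m*n (t ℤ.* r) P∣Ps)))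
  where
  tail∈P : ∀ t {x} → L (x +ᵛ t • + P • a) → Multiple P x
  tail∈P t x∈ = Multiple-+•⁻ t (L⊆P x∈) (Multiple-• P a)
  P∣Ps : + P ∣ℤ + (P * s)
  P∣Ps = divides (+ s) (trans (cong +_ (ℕ.*-comm P s)) (ℤ.pos-* s P))
  lemma : ∀ t r m → (t ℤ.* m) ℤ.* (r ℤ.* m) ≡ (t ℤ.* r ℤ.* m) ℤ.* m
  lemma = solve-∀

-- Lattices built from matrices.

-- The same set as `Multiple Q`, put in the form of iterated `Ext` so that `Ext-index` computes its
-- index.
Scaled : ℕ → ∀ d → Pred (ℤ^ d) 0ℓ
Scaled Q zero    = U
Scaled Q (suc d) = Ext Q 0ᵛ (Scaled Q d)

Scaled-isSublattice : ∀ Q d → IsSublattice (Scaled Q d)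
Scaled-isSublattice Q zero    = record { 0∈ = tt ; linear = λ _ _ _ → tt }
Scaled-isSublattice Q (suc d) = Ext-isSublattice (Scaled-isSublattice Q d)

Scaled-index : ∀ Q .{{_ : NonZero Q}} d → Index (Scaled Q d) (Q ^ d)
Scaled-index Q zero    = record
  { label     = λ _ → Fin.zero
  ; rep       = λ _ → []
  ; label-rep = λ { Fin.zero → refl }
  ; sound     = λ _ → tt
  ; complete  = λ _ → refl
  }
Scaled-index Q (suc d) = Ext-index (Scaled-index Q d)

Multiple⇒Scaled : ∀ d → Multiple Q ⊆ Scaled Q d
Multiple⇒Scaled zero    []                           = tt
Multiple⇒Scaled {Q} (suc d) {_ ∷ x} (divides t eq ∷ ps) =
  t , eq , subst (Scaled Q d) (sym (x+t•0≡x t x)) (Multiple⇒Scaled d ps)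

Scaled⇒Multiple : ∀ d → Scaled Q d ⊆ Multiple Q
Scaled⇒Multiple zero    {[]}    _              = []
Scaled⇒Multiple {Q} (suc d) {_ ∷ x} (t , eq , x∈) =
  divides t eq ∷ Scaled⇒Multiple d (subst (Scaled Q d) (x+t•0≡x t x) x∈)

Matrix : ℕ → ℕ → ℕ → Set
Matrix P j d = Fin j → Fin d → Fin P

entries : (Fin d → Fin P) → ℤ^ d
entries α = tabulate (λ i → + toℕ (α i))

row : ∀ j → (Fin d → Fin P) → ℤ^ (j + d)
row {P = P} j α = + P • (0ᵛ {j} ++ entries α)

-- Spanned by the rows P(e_h - A_h) and by P²ℤᵈ in the last d coordinates.
Lat : ∀ j → Matrix P j d → Pred (ℤ^ (j + d)) 0ℓ
Lat {P} {d} zero    A = Scaled (P * P) d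
Lat {P} {d} (suc j) A = Ext P (row j (A Fin.zero)) (Lat j (A ∘ Fin.suc))

-- `Lat (suc j) A` is the case `m = P`. The free pivot later becomes `P * s`, which multiplies the
-- index by `s`.
TopLat : ℕ → ∀ j → Matrix P (suc j) d → Pred (ℤ^ (suc j + d)) 0ℓ
TopLat m j A = Ext m (row j (A Fin.zero)) (Lat j (A ∘ Fin.suc))

Lat-isSublattice : ∀ j (A : Matrix P j d) → IsSublattice (Lat j A)
Lat-isSublattice {P} {d} zero    A = Scaled-isSublattice (P * P) d
Lat-isSublattice (suc j) A = Ext-isSublattice (Lat-isSublattice j (A ∘ Fin.suc))

module _ .{{_ : NonZero P}} where

  private instance
    P*P≢0 : NonZero (P * P)
    P*P≢0 = ℕ.m*n≢0 P P

  Lat-index : ∀ j (A : Matrix P j d) → Index (Lat j A) (P ^ j * (P * P) ^ d)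
  Lat-index {d} zero    A = subst (Index _) (sym (ℕ.*-identityˡ _)) (Scaled-index (P * P) d)
  Lat-index {d} (suc j) A = subst (Index _) (sym (ℕ.*-assoc P (P ^ j) ((P * P) ^ d)))
    (Ext-index (Lat-index j (A ∘ Fin.suc)))

  -- With `Lat⇒Multiple`, this gives the two inclusions that `Ext-*-closed` asks of the rows below
  -- the top one.
  Multiple⇒Lat : ∀ j (A : Matrix P j d) → Multiple (P * P) ⊆ Lat j A
  Multiple⇒Lat {d} zero    A ps = Multiple⇒Scaled d ps
  Multiple⇒Lat (suc j) A (divides q refl ∷ ps) =
    -- A first coordinate `q` times `P * P` takes `q ℤ.* + P` copies of the pivot row, and these
    -- change the tail by a multiple of `P * P` too.
    q ℤ.* + P , trans (cong (q ℤ.*_) (ℤ.pos-* P P)) (sym (ℤ.*-assoc q (+ P) (+ P))) ,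
    Multiple⇒Lat j (A ∘ Fin.suc) (Multiple-+ ps
      (Multiple-t•P• (0ᵛ {j} ++ entries (A Fin.zero)) (divides q refl)))

  Lat⇒Multiple : ∀ j (A : Matrix P j d) → Lat j A ⊆ Multiple P
  Lat⇒Multiple {d} zero A x∈ = weaken (Scaled⇒Multiple d x∈)
    where
    weaken : ∀ {n} {x : ℤ^ n} → Multiple (P * P) x → Multiple P x
    weaken []       = []
    weaken (p ∷ ps) = ℤ∣.∣-trans (divides (+ P) (ℤ.pos-* P P)) p ∷ weaken ps
  Lat⇒Multiple (suc j) A {_ ∷ x} (t , refl , x∈) = divides t refl ∷
    Multiple-+•⁻ t (Lat⇒Multiple j (A ∘ Fin.suc) x∈) (Multiple-• P (0ᵛ {j} ++ entries (A Fin.zero)))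

  -- Cancelling `P` turns divisibility by `P * P` into congruence mod `P`, and the entries are
  -- residues below `P`.
  entries-≡ : ∀ {d} (α β : Fin d → Fin P) → Multiple (P * P) (+ P • entries β -ᵛ + P • entries α) →
              ∀ i → α i ≡ β i
  entries-≡ α β (p ∷ ps) (Fin.suc i) = entries-≡ (α ∘ Fin.suc) (β ∘ Fin.suc) ps i
  entries-≡ α β (p ∷ ps) Fin.zero    = sym (Fin.toℕ-injective
    (∣-bounded⇒≡ (Fin.toℕ<n (β Fin.zero)) (Fin.toℕ<n (α Fin.zero))
      (ℤ∣.*-cancelˡ-∣ (+ P) (subst₂ _∣ℤ_ (ℤ.pos-* P P) (lemma (+ P) b₀ a₀) p))))
    where
    a₀ b₀ : ℤ
    a₀ = + toℕ (α Fin.zero)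
    b₀ = + toℕ (β Fin.zero)
    lemma : ∀ P b a → P ℤ.* b ℤ.- P ℤ.* a ≡ P ℤ.* (b ℤ.- a)
    lemma = solve-∀

  -- The difference of the two rows vanishes in the first `j` coordinates, so no row of `A`
  -- contributes, and a congruence mod `P * P` on the last `d` coordinates remains.
  Lat-rows : ∀ j (A : Matrix P j d) (α β : Fin d → Fin P) →
             Lat j A (row j β -ᵛ row j α) → ∀ i → α i ≡ β i
  Lat-rows {d} zero    A α β p = entries-≡ α β (Scaled⇒Multiple d p)
  Lat-rows     (suc j) A α β p = Lat-rows j (A ∘ Fin.suc) α β
    (0∷⁻ {a = row j (A Fin.zero)} {Lat j (A ∘ Fin.suc)} (lemma (+ P)) p)
    where
    lemma : ∀ P → P ℤ.* 0ℤ ℤ.- P ℤ.* 0ℤ ≡ 0ℤ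
    lemma = solve-∀

  -- `Ext-⊆⇒rows` gives the first row. Dropping it leaves a nonempty `Lat`, which is a `TopLat` with
  -- pivot `P`, so the argument repeats with `P` for `m`.
  TopLat-injective : ∀ .{{_ : NonZero m}} j (A B : Matrix P (suc j) d) →
                     TopLat m j A ⊆ TopLat m j B → ∀ h i → A h i ≡ B h i
  TopLat-injective j A B A⊆B Fin.zero =
    Lat-rows j (B ∘ Fin.suc) (A Fin.zero) (B Fin.zero)
      (Ext-⊆⇒rows {a = row j (A Fin.zero)} {row j (B Fin.zero)} (Lat-isSublattice j (A ∘ Fin.suc)) A⊆B)
  TopLat-injective (suc j) A B A⊆B (Fin.suc h) =
    TopLat-injective j (A ∘ Fin.suc) (B ∘ Fin.suc)
      (Ext-⊆⇒⊆ {a = row (suc j) (A Fin.zero)} {row (suc j) (B Fin.zero)}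
        {Lat (suc j) (A ∘ Fin.suc)} {Lat (suc j) (B ∘ Fin.suc)} A⊆B) h

-- Counting the subrings.

-- `funToFin` respects pointwise equality, which replaces function extensionality.
finToFun-injective : ∀ j {x y : Fin (m ^ j)} → (∀ i → finToFun x i ≡ finToFun y i) → x ≡ y
finToFun-injective {m} j {x} {y} eq =
  trans (sym (Fin.funToFin-finToFin {j} x)) (trans (funToFin-cong j eq) (Fin.funToFin-finToFin {j} y))
  where
  funToFin-cong : ∀ j {g h : Fin j → Fin m} → (∀ i → g i ≡ h i) → funToFin g ≡ funToFin h
  funToFin-cong zero    eq = refl
  funToFin-cong (suc j) eq = cong₂ combine (eq Fin.zero) (funToFin-cong j (eq ∘ Fin.suc))

module _ (P s j d : ℕ) .{{_ : NonZero P}} .{{_ : NonZero s}} where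

  private
    instance
      P*s≢0 : NonZero (P * s)
      P*s≢0 = ℕ.m*n≢0 P s
    N = suc (suc j + d)
    -- The product of the pivots: 1 for the all-ones row, the adjusted `P * s`, then `j` times `P`
    -- and `d` times `P * P`.
    I = 1 * (P * s * (P ^ j * (P * P) ^ d))
    module Sub = Setoid (subringsOfIndex N I)

    matrix : Fin ((P ^ d) ^ suc j) → Matrix P (suc j) d
    matrix i h = finToFun (finToFun i h)

    subring : Matrix P (suc j) d → Sub.Carrier
    subring A = S , Index⇒HasIndex S (Ext-index (Ext-index (Lat-index j A′)))
      where
      A′ = A ∘ Fin.suc
      a = 0ᵛ {j} ++ entries (A Fin.zero)
      S = unitalization (Ext-isSublattice {m = P * s} {+ P • a} (Lat-isSublattice j A′))
        (Ext-*-closed {P = P} {s} a (Multiple⇒Lat j A′) (Lat⇒Multiple j A′))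

    subring-injective : ∀ x y → subring (matrix x) Sub.≈ subring (matrix y) → x ≡ y
    subring-injective x y (S⊆T , _) = finToFun-injective (suc j) λ h → finToFun-injective d
      (TopLat-injective {m = P * s} j (matrix x) (matrix y)
        (Ext-⊆⇒⊆ {m = 1} {L = TopLat (P * s) j (matrix x)} {TopLat (P * s) j (matrix y)} S⊆T) h)

  count : (P ^ d) ^ suc j ≤ f N I
  count = Fin.injective⇒≤ {f = to ∘ subring ∘ matrix} λ {x} {y} eq → subring-injective x y (injective eq)
    where open Bijection (f-counts N I)

-- Choice of parameters and the maximum.

-- Take `P = p ^ k` and `s = p ^ r` in `count`. The pivots contribute `k + r`, `k * j` and
-- `(k + k) * d` to the exponent of the index.
lower-bound : ∀ p .{{_ : NonZero p}} k r d j →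
  p ^ (k * d * suc j) ≤ f (suc (suc (j + d))) (p ^ (r + k * (suc (j + d) + d)))
lower-bound p k r d j = subst₂ (λ x y → x ≤ f (suc (suc (j + d))) y) count≡ index≡
  (count (p ^ k) (p ^ r) j d {{ℕ.m^n≢0 p k}} {{ℕ.m^n≢0 p r}})
  where
  open ≡-Reasoning
  count≡ : ((p ^ k) ^ d) ^ suc j ≡ p ^ (k * d * suc j)
  count≡ = trans (cong (_^ suc j) (ℕ.^-*-assoc p k d)) (ℕ.^-*-assoc p (k * d) (suc j))
  exponent≡ : ∀ k r j d → k + r + (k * j + (k + k) * d) ≡ r + k * (suc (j + d) + d)
  exponent≡ = ℕ-Solver.solve-∀
  index≡ : 1 * (p ^ k * p ^ r * ((p ^ k) ^ j * (p ^ k * p ^ k) ^ d)) ≡ p ^ (r + k * (suc (j + d) + d))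
  index≡ = begin
    1 * (p ^ k * p ^ r * ((p ^ k) ^ j * (p ^ k * p ^ k) ^ d))
      ≡⟨ ℕ.*-identityˡ _ ⟩
    p ^ k * p ^ r * ((p ^ k) ^ j * (p ^ k * p ^ k) ^ d)
      ≡⟨ cong₂ _*_ (ℕ.^-distribˡ-+-* p k r)
           (cong₂ _*_ (sym (ℕ.^-*-assoc p k j)) (cong (_^ d) (ℕ.^-distribˡ-+-* p k k))) ⟨
    p ^ (k + r) * (p ^ (k * j) * (p ^ (k + k)) ^ d)
      ≡⟨ cong (λ x → p ^ (k + r) * (p ^ (k * j) * x)) (ℕ.^-*-assoc p (k + k) d) ⟩
    p ^ (k + r) * (p ^ (k * j) * p ^ ((k + k) * d))
      ≡⟨ cong (p ^ (k + r) *_) (ℕ.^-distribˡ-+-* p (k * j) _) ⟨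
    p ^ (k + r) * p ^ (k * j + (k + k) * d)
      ≡⟨ ℕ.^-distribˡ-+-* p (k + r) _ ⟨
    p ^ (k + r + (k * j + (k + k) * d))
      ≡⟨ cong (p ^_) (exponent≡ k r j d) ⟩
    p ^ (r + k * (suc (j + d) + d)) ∎

-- The case `k = 0`, `d = 0` of `lower-bound`, with all of `e` put into the adjusted pivot.
1≤f : ∀ p .{{_ : NonZero p}} n e → 1 ≤ f (suc (suc n)) (p ^ e)
1≤f p n e = subst₂ (λ m x → 1 ≤ f (suc (suc m)) (p ^ x)) (ℕ.+-identityʳ n) (ℕ.+-identityʳ e)
  (lower-bound p 0 e 0 n)

b-term-bound : ∀ p .{{_ : NonZero p}} n e {d} → d < suc (suc n) →
  p ^ b-term (suc (suc n)) e d ≤ f (suc (suc n)) (p ^ e)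
b-term-bound p n e {d} (s≤s d≤1+n) with ℕ.m≤n⇒m<n∨m≡n d≤1+n
-- For the largest `d` there is no row to carry the adjusted pivot, so `lower-bound` does not apply;
-- but then the term is 0.
... | inj₂ refl = subst (λ x → p ^ x ≤ f (suc (suc n)) (p ^ e)) (sym exponent≡0) (1≤f p n e)
  where
  exponent≡0 : b-term (suc (suc n)) e (suc n) ≡ 0
  exponent≡0 = trans (cong (e / (suc n + suc n) * suc n *_) (ℕ.n∸n≡0 n))
    (ℕ.*-zeroʳ (e / (suc n + suc n) * suc n))
-- There are `suc j` matrix rows, where `d + j` is `n`. Division of `e` by `D` supplies `k` as the
-- quotient and `r` as the remainder.
... | inj₁ (s≤s d≤n) with ℕ.m≤n⇒∃[o]m+o≡n d≤n
...   | j , refl = subst₂ (λ m x → p ^ (e / D * d * x) ≤ m) f≡ j≡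
  (lower-bound p (e / D) (e % D) d j)
  where
  D = suc (d + j) + d
  j≡ : suc j ≡ suc (d + j) ∸ d
  j≡ = sym (trans (cong (_∸ d) (sym (ℕ.+-suc d j))) (ℕ.m+n∸m≡n d (suc j)))
  f≡ : f (suc (suc (j + d))) (p ^ (e % D + e / D * (suc (j + d) + d))) ≡ f (suc (suc (d + j))) (p ^ e)
  f≡ = trans (cong (λ m → f (suc (suc m)) (p ^ (e % D + e / D * (suc m + d)))) (ℕ.+-comm j d))
    (cong (λ x → f (suc (suc (d + j))) (p ^ x)) (sym (m≡m%n+[m/n]*n e D)))

theorem1p9 : (n e p : ℕ) .{{_ : NonTrivial n}} → n ∸ 1 ≤ e → Prime p →
    p ^ b n e ≤ f n (p ^ e)
theorem1p9 n@(suc (suc n-2)) e p _ p-prime =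
  -- The maximum is the default 0, covered by `1≤f`, or one of the listed terms.
  argmax-all id {P = λ x → p ^ x ≤ f n (p ^ e)} (1≤f p n-2 e)
    (List.map⁺ (List.applyUpTo⁺₁ id n (b-term-bound p n-2 e)))
  where instance
    p≢0 : NonZero p
    p≢0 = prime⇒nonZero p-prime
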